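{- Let $G=(V,E,w)$ be a finite connected graph with $|V|=n\ge2$ and weights $w:E\to\mathbb{R}_{>0}$. Then $$\operatorname{OPT}_{\mathrm{free}}(G,w)=\min_{T\in\mathcal T_{\mathrm{conn}}^{\mathrm{bin}}(G)}\ \sum_{xy\in E}w_{xy}\operatorname{diam}_{d_G}\bigl(C_T(x,y)\bigr).$$ In particular, the free optimum $\operatorname{OPT}_{\mathrm{free}}(G,w)$ is attained by the diameter labeling $u_T^{\mathrm{diam}}$ of some connected binary hierarchy $T\in\mathcal T_{\mathrm{conn}}^{\mathrm{bin}}(G)$.
   Context: $d_G$ is the shortest-path metric of the support graph $(V,E)$ with every edge of length $1$; the weights are not edge lengths. An ultrametric on $V$ is a metric $u$ on $V$ with $u(x,y)\le\max\{u(x,z),u(z,y)\}$ for all $x,y,z$; it dominates $d_G$ if $u(x,y)\ge d_G(x,y)$ for all $x,y\in V$. $\operatorname{OPT}_{\mathrm{free}}(G,w)$ is the minimum (a priori, infimum) of $\sum_{xy\in E}w_{xy}u(x,y)$ over all ultrametrics $u$ on $V$ dominating $d_G$. A rooted binary hierarchy $T$ on $V$ is a rooted tree whose leaves are the vertices of $V$ and whose internal nodes have exactly two children; each node is identified with the set of leaves below it (a cluster), and $C_T(x,y)$ is the cluster of the lowest common ancestor of $x,y$. $\mathcal T_{\mathrm{conn}}^{\mathrm{bin}}(G)$ is the set of rooted binary hierarchies on $V$ all of whose clusters induce connected subgraphs of $G$. $\operatorname{diam}_{d_G}(S)=\max_{a,b\in S}d_G(a,b)$. The diameter labeling is $u_T^{\mathrm{diam}}(x,x)=0$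 and $u_T^{\mathrm{diam}}(x,y)=\operatorname{diam}_{d_G}(C_T(x,y))$ for $x\neq y$. -}

module Defs where

open import Algebra.Bundles using (CommutativeRing)
import Algebra.Construct.NaturalChoice.Max as NaturalMax
import Algebra.Definitions.RawMonoid as RawMonoidDefs
open import Data.Bool.Base using (if_then_else_)
open import Data.Fin.Base using (Fin)
open import Data.Fin.Properties using (_≟_; _<?_; any?)
open import Data.Fin.Subset using (Subset; ⁅_⁆; _∪_; _∩_; Empty; ⊤; _∈_)
open import Data.Fin.Subset.Properties using (_∈?_)
open import Data.List.Base using (List; allFin; filter; cartesianProductWith)
open import Data.List.Extrema.Nat using (max)
open import Data.Nat.Base as ℕ using (ℕ; zero; suc)
import Data.Nat.Properties as ℕ
open import Data.Product.Base using (_×_; _,_; ∃; ∃-syntax; proj₁)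
open import Function.Metric.Definitions using (TriangleInequality)
open import Function.Metric.Structures using (IsGeneralMetric)
open import Level using (0ℓ)
open import Relation.Binary.Bundles using (DecTotalOrder)
open import Relation.Binary.Core using (Rel)
open import Relation.Binary.Definitions using (Decidable)
open import Relation.Binary.PropositionalEquality.Core using (_≡_; refl)
open import Relation.Binary.Structures using (IsDecTotalOrder)
open import Relation.Nullary.Decidable
  using (Dec; yes; no; does; map′; _×-dec_)
open import Relation.Nullary.Negation using (¬_; contradiction)
open import Relation.Unary using (Pred)

------------------------------------------------------------------------
-- Real numbers

module Bounds {A : Set} (_≤_ : Rel A 0ℓ) where

  IsUpperBound : Pred A 0ℓ → Pred A 0ℓ
  IsUpperBound P b = ∀ r → P r → r ≤ b

  IsLowerBound : Pred A 0ℓ → Pred A 0ℓ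
  IsLowerBound P b = ∀ r → P r → b ≤ r

  IsSupremum : Pred A 0ℓ → Pred A 0ℓ
  IsSupremum P s = IsUpperBound P s × (∀ b → IsUpperBound P b → s ≤ b)

  IsInfimum : Pred A 0ℓ → Pred A 0ℓ
  IsInfimum P s = IsLowerBound P s × (∀ b → IsLowerBound P b → b ≤ s)

  IsMinimum : Pred A 0ℓ → Pred A 0ℓ
  IsMinimum P m = P m × IsLowerBound P m

-- ℝ is given by its classical axioms: a Dedekind-complete totally ordered
-- field, which is unique up to isomorphism. The trichotomy of the classical
-- reals is expressed by the order being a decidable total order.

record Reals : Set₁ where
  field
    commutativeRing : CommutativeRing 0ℓ 0ℓ

  open CommutativeRing commutativeRing public
    using (Carrier; _≈_; _+_; _*_; 0#; 1#; +-rawMonoid)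

  infix 4 _≤_ _<ᴿ_
  field
    _≤_             : Rel Carrier 0ℓ
    isDecTotalOrder : IsDecTotalOrder _≈_ _≤_
    0≉1             : ¬ (0# ≈ 1#)
    inverse         : ∀ x → ¬ (x ≈ 0#) → ∃[ y ] (x * y) ≈ 1#
    +-monoˡ-≤       : ∀ z {x y} → x ≤ y → (x + z) ≤ (y + z)
    *-nonNegative   : ∀ {x y} → 0# ≤ x → 0# ≤ y → 0# ≤ (x * y)

  open Bounds _≤_ public

  field
    supremum : (P : Pred Carrier 0ℓ) → ∃ P → ∃ (IsUpperBound P) →
               ∃ (IsSupremum P)

  decTotalOrder : DecTotalOrder 0ℓ 0ℓ 0ℓ
  decTotalOrder = record { isDecTotalOrder = isDecTotalOrder }

  open NaturalMax (DecTotalOrder.totalOrder decTotalOrder) public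
    using (_⊔_)

  _<ᴿ_ : Rel Carrier 0ℓ
  x <ᴿ y = x ≤ y × ¬ (x ≈ y)

  open RawMonoidDefs +-rawMonoid public using (sum)
    renaming (_×_ to _×ᴿ_)

  fromℕ : ℕ → Carrier
  fromℕ k = k ×ᴿ 1#

------------------------------------------------------------------------
-- Graphs

record Graph (n : ℕ) : Set₁ where
  infix 4 _~_ _~?_
  field
    _~_      : Rel (Fin n) 0ℓ
    _~?_     : Decidable _~_
    ~-sym    : ∀ {x y} → x ~ y → y ~ x
    ~-irrefl : ∀ {x} → ¬ (x ~ x)

data Walk {n : ℕ} (_~_ : Rel (Fin n) 0ℓ) : ℕ → Fin n → Fin n → Set where
  []  : ∀ {x} → Walk _~_ zero x x
  _∷_ : ∀ {k x y z} → x ~ y → Walk _~_ k y z → Walk _~_ (suc k) x z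

Connected : ∀ {n} → Graph n → Set
Connected G = ∀ x y → ∃[ k ] Walk (Graph._~_ G) k x y

InducesConnected : ∀ {n} → Graph n → Subset n → Set
InducesConnected G S =
  ∀ x y → x ∈ S → y ∈ S → ∃[ k ] Walk (λ a b → a ∈ S × b ∈ S × a ~ b) k x y
  where open Graph G

walk? : ∀ {n} {_~_ : Rel (Fin n) 0ℓ} → Decidable _~_ →
        ∀ k x y → Dec (Walk _~_ k x y)
walk? _~?_ zero    x y = map′ (λ { refl → [] }) (λ { [] → refl }) (x ≟ y)
walk? _~?_ (suc k) x z =
  map′ (λ { (_ , e , p) → e ∷ p }) (λ { (e ∷ p) → _ , e , p })
       (any? λ y → (x ~? y) ×-dec walk? _~?_ k y z)

least : {P : Pred ℕ 0ℓ} → (∀ k → Dec (P k)) → ∀ k → P k →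
        ∃ (Bounds.IsMinimum ℕ._≤_ P)
least P? zero    p = zero , p , λ _ _ → ℕ.z≤n
least P? (suc k) p with P? zero
... | yes p₀ = zero , p₀ , λ _ _ → ℕ.z≤n
... | no ¬p₀ with least (λ m → P? (suc m)) k p
...   | m , pₘ , below = suc m , pₘ , λ where
        zero    p₀ → contradiction p₀ ¬p₀
        (suc r) pᵣ → ℕ.s≤s (below r pᵣ)

module _ {n : ℕ} (G : Graph n) (conn : Connected G) where
  open Graph G

  shortest : ∀ x y → ∃ (Bounds.IsMinimum ℕ._≤_ (λ k → Walk _~_ k x y))
  shortest x y = let (k , p) = conn x y in least (λ m → walk? _~?_ m x y) k p

  dist : Fin n → Fin n → ℕ
  dist x y = proj₁ (shortest x y)

  diam : Subset n → ℕ
  diam S = max 0 (cartesianProductWith dist elements elements)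
    where
    elements : List (Fin n)
    elements = filter (_∈? S) (allFin n)

------------------------------------------------------------------------
-- Rooted binary hierarchies

-- A binary tree, indexed by the cluster of its root; sibling clusters are
-- disjoint, so every element of the cluster labels exactly one leaf.

data Tree {n : ℕ} : Subset n → Set where
  leaf : ∀ x → Tree ⁅ x ⁆
  node : ∀ {S T} → Empty (S ∩ T) → Tree S → Tree T → Tree (S ∪ T)

Hierarchy : ℕ → Set
Hierarchy n = Tree {n} ⊤

AllClusters : ∀ {n} {S : Subset n} → Pred (Subset n) 0ℓ → Tree S → Set
AllClusters P (leaf x)                 = P ⁅ x ⁆
AllClusters P (node {S = S} {T} _ l r) =
  P (S ∪ T) × AllClusters P l × AllClusters P r

-- The cluster of the lowest common ancestor. Only meaningful when x and y
-- are both in the cluster of the root, as is always so for a Hierarchy.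

lca : ∀ {n} {S : Subset n} → Tree S → Fin n → Fin n → Subset n
lca (leaf z)                 x y = ⁅ z ⁆
lca (node {S = S} {T} _ l r) x y =
  if does ((x ∈? S) ×-dec (y ∈? S)) then lca l x y else
  if does ((x ∈? T) ×-dec (y ∈? T)) then lca r x y else
  S ∪ T

ConnectedHierarchy : ∀ {n} → Graph n → Hierarchy n → Set
ConnectedHierarchy G = AllClusters (InducesConnected G)

------------------------------------------------------------------------
-- Weights and costs

module _ (ℝ : Reals) where
  open Reals ℝ

  -- Taking p and q both arbitrary, w-sym also makes the weight independent
  -- of the proof of adjacency.

  record Weighting {n : ℕ} (G : Graph n) : Set where
    open Graph G
    field
      w     : ∀ {x y} → x ~ y → Carrier
      w-sym : ∀ {x y} (p : x ~ y) (q : y ~ x) → w p ≈ w q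
      w-pos : ∀ {x y} (p : x ~ y) → 0# <ᴿ w p

  when : {P : Set} → Dec P → (P → Carrier) → Carrier
  when (yes p) f = f p
  when (no _)  f = 0#

  -- Each edge {x , y} is counted once, with x < y.

  cost : ∀ {n} {G : Graph n} → Weighting G → (Fin n → Fin n → Carrier) →
         Carrier
  cost {G = G} W u =
    sum λ x → sum λ y →
      when ((x <? y) ×-dec (x ~? y)) λ { (_ , p) → w p * u x y }
    where
    open Graph G
    open Weighting W

  record IsUltrametric {n : ℕ} (u : Fin n → Fin n → Carrier) : Set where
    field
      isMetric      : IsGeneralMetric _≡_ _≈_ _≤_ 0# _+_ u
      ultratriangle : TriangleInequality _≤_ _⊔_ u

  module _ {n : ℕ} (G : Graph n) (conn : Connected G) where

    Dominates : (Fin n → Fin n → Carrier) → Set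
    Dominates u = ∀ x y → fromℕ (dist G conn x y) ≤ u x y

    diamLabeling : Hierarchy n → Fin n → Fin n → Carrier
    diamLabeling T x y =
      if does (x ≟ y) then 0# else fromℕ (diam G conn (lca T x y))

    module _ (W : Weighting G) where

      FreeCost : Pred Carrier 0ℓ
      FreeCost r = ∃[ u ] IsUltrametric u × Dominates u × cost W u ≈ r

      IsOPTfree : Pred Carrier 0ℓ
      IsOPTfree = IsInfimum FreeCost

      HierarchyCost : Pred Carrier 0ℓ
      HierarchyCost r =
        ∃[ T ] ConnectedHierarchy G T ×
               cost W (λ x y → fromℕ (diam G conn (lca T x y))) ≈ r

module Submission where

-- Every dominating ultrametric u is matched, edge by edge, by the diameter
-- labeling of a connected binary hierarchy obtained greedily from u: start
-- with the single vertices as clusters and repeatedly join the two clusters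
-- at the ends of a crossing edge xy of least u-value. All points of one
-- cluster are then at u-distance at most the u-value of every crossing edge.
-- At the moment of joining, the strong triangle inequality through x and y
-- bounds all u-distances in the new cluster M by u(x,y). As u dominates the
-- graph metric, diam M is at most u(x,y), which by minimality is at most
-- u(p,q) for every edge pq whose ends are joined at this step; and M is the
-- cluster of the lowest common ancestor of p and q. Weights being positive,
-- the hierarchy costs no more than u. This step is respects-merge.
--
-- A minimum over hierarchies has to exist as well, without any enumeration
-- of hierarchies. The lemma cheapestAbove reverses the quantifiers: for each
-- forest of disjoint connected clusters it gives one hierarchy at least as
-- cheap as every dominating ultrametric compatible with the forest. It tries every
-- crossing edge, recurses into the merged forest, and keeps the cheapest of
-- the finitely many results. A given ultrametric stays compatible with the
-- branch that merges its own least crossing edge, so it costs at least as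
-- much as the result of that branch, and hence as the one that was kept.
--
-- Conversely, the diameter labeling of any hierarchy is itself a dominating
-- ultrametric (diamLabeling-ultrametric, diamLabeling-dominates), as the
-- lowest common ancestors satisfy the ultrametric law with respect to
-- inclusion (lca-ultra). So the cheapest hierarchy bounds from below the
-- costs of ultrametrics and of hierarchies alike, and attains both.

open import Defs
open import Algebra.Bundles using (CommutativeRing)
import Algebra.Construct.NaturalChoice.Max as NaturalMax
import Algebra.Properties.Ring as RingProperties
open import Data.Bool.Base using (if_then_else_)
open import Data.Fin.Base using (Fin; zero; suc)
open import Data.Fin.Properties using (_≟_; _<?_)
open import Data.Fin.Subset using (Subset; ⁅_⁆; _∪_; _∩_; Empty; ⊤; _∈_; _∉_; _⊆_)
open import Data.Fin.Subset.Properties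
  using ( _∈?_; x∈⁅x⁆; x∈⁅y⁆⇒x≡y; x∈p∩q⁺; x∈p∩q⁻; x∈p∪q⁻; p⊆p∪q; q⊆p∪q
        ; ∈⊤; ⊆⊤; ⊆-antisym)
open import Data.List.Base using (List; []; _∷_; allFin; cartesianProduct; filter; length; lookup)
import Data.List.Extrema as Extrema
open import Data.List.Extrema.Nat using (argmax-all; xs≤max)
open import Data.List.Membership.Propositional using (lose) renaming (_∈_ to _∈ₗ_)
open import Data.List.Membership.Propositional.Properties
  using ( ∈-allFin; ∈-cartesianProduct⁺; ∈-cartesianProductWith⁺; ∈-filter⁺
        ; ∈-filter⁻; ∈-lookup)
open import Data.List.Properties using (filter-notAll)
import Data.List.Relation.Unary.All as All
open import Data.List.Relation.Unary.All.Properties using (cartesianProductWith⁺)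
open import Data.List.Relation.Unary.Any using (index)
open import Data.List.Relation.Unary.Any.Properties using (lookup-index)
open import Data.Nat.Base using (ℕ; _≤_; zero; suc; z≤n; s≤s)
import Data.Nat.Properties as ℕ
open import Data.Product.Base using (_×_; _,_; ∃; ∃-syntax; proj₁; proj₂)
open import Data.Sum.Base using (_⊎_; inj₁; inj₂; [_,_]′)
open import Function.Base using (_∘_; id)
open import Function.Metric.Structures using (IsGeneralMetric)
open import Level using (0ℓ)
open import Relation.Binary.Bundles using (DecTotalOrder)
open import Relation.Binary.Core using (Rel)
open import Relation.Binary.PropositionalEquality
  using (_≡_; _≢_; refl; sym; trans; cong; subst; isEquivalence; setoid)
open import Relation.Nullary.Decidable using (Dec; yes; no; does; ¬?; _×-dec_)
open import Relation.Nullary.Negation using (¬_; contradiction)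

------------------------------------------------------------------------
-- Lowest common ancestors

module _ {n : ℕ} where

  -- Indexing the view by the value of lca lets a single match settle both the
  -- case distinction and the value, without rewriting under the conditionals.
  data LcaView {S T : Subset n} (l : Tree S) (r : Tree T) (x y : Fin n) :
               Subset n → Set where
    left  : x ∈ S → y ∈ S → LcaView l r x y (lca l x y)
    right : x ∈ T → y ∈ T → LcaView l r x y (lca r x y)
    apart : ¬ (x ∈ S × y ∈ S) → ¬ (x ∈ T × y ∈ T) → LcaView l r x y (S ∪ T)

  lca-view : ∀ {S T} (d : Empty (S ∩ T)) (l : Tree S) (r : Tree T) x y →
             LcaView l r x y (lca (node d l r) x y)
  lca-view {S} {T} d l r x y =
    choose ((x ∈? S) ×-dec (y ∈? S)) ((x ∈? T) ×-dec (y ∈? T))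
    where
    choose : (p : Dec (x ∈ S × y ∈ S)) (q : Dec (x ∈ T × y ∈ T)) →
             LcaView l r x y (if does p then lca l x y else
                              if does q then lca r x y else S ∪ T)
    choose (yes (x∈S , y∈S)) _                 = left x∈S y∈S
    choose (no _)            (yes (x∈T , y∈T)) = right x∈T y∈T
    choose (no ¬S)           (no ¬T)           = apart ¬S ¬T

  lca-⊆ : ∀ {S : Subset n} (t : Tree S) x y → lca t x y ⊆ S
  lca-⊆ (leaf z)     x y = id
  lca-⊆ (node d l r) x y with lca (node d l r) x y | lca-view d l r x y
  ... | _ | left _ _  = p⊆p∪q _ ∘ lca-⊆ l x y
  ... | _ | right _ _ = q⊆p∪q _ _ ∘ lca-⊆ r x y
  ... | _ | apart _ _ = id

  lca-∋ : ∀ {S : Subset n} (t : Tree S) {x y} → x ∈ S → y ∈ S →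
          x ∈ lca t x y × y ∈ lca t x y
  lca-∋ (leaf z)     x∈ y∈ = x∈ , y∈
  lca-∋ (node d l r) {x} {y} x∈ y∈
    with lca (node d l r) x y | lca-view d l r x y
  ... | _ | left x∈S y∈S  = lca-∋ l x∈S y∈S
  ... | _ | right x∈T y∈T = lca-∋ r x∈T y∈T
  ... | _ | apart _ _     = x∈ , y∈

  disjoint : ∀ {S T : Subset n} {x} → Empty (S ∩ T) → x ∈ S → ¬ (x ∈ T)
  disjoint d x∈S x∈T = d (_ , x∈p∩q⁺ (x∈S , x∈T))

  -- The clusters containing two given vertices form a chain, whose least
  -- member is the lowest common ancestor.
  lca-least : ∀ {S : Subset n} (t : Tree S) a b {x y} → x ∈ lca t a b → y ∈ lca t a b →
              lca t x y ⊆ lca t a b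
  lca-least (leaf z)     a b x∈ y∈ = id
  lca-least (node d l r) a b {x} {y} x∈ y∈
    with lca (node d l r) a b | lca-view d l r a b
       | lca (node d l r) x y | lca-view d l r x y | lca-⊆ (node d l r) x y
  ... | _ | apart _ _ | _ | _             | ⊆root = ⊆root
  ... | _ | left _ _  | _ | left _ _      | _ = lca-least l a b x∈ y∈
  ... | _ | left _ _  | _ | right x∈T _   | _ =
    contradiction x∈T (disjoint d (lca-⊆ l a b x∈))
  ... | _ | left _ _  | _ | apart ¬S _    | _ =
    contradiction (lca-⊆ l a b x∈ , lca-⊆ l a b y∈) ¬S
  ... | _ | right _ _ | _ | left x∈S _    | _ =
    contradiction (lca-⊆ r a b x∈) (disjoint d x∈S)
  ... | _ | right _ _ | _ | right _ _     | _ = lca-least r a b x∈ y∈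
  ... | _ | right _ _ | _ | apart _ ¬T    | _ =
    contradiction (lca-⊆ r a b x∈ , lca-⊆ r a b y∈) ¬T

  -- If a node of the tree separates y from x or from z, the corresponding
  -- ancestor is that whole node; otherwise all three lie below one child.
  lca-ultra : ∀ {S : Subset n} (t : Tree S) x y z →
              lca t x z ⊆ lca t x y ⊎ lca t x z ⊆ lca t y z
  lca-ultra (leaf _)     x y z = inj₁ id
  lca-ultra (node d l r) x y z
    with lca (node d l r) x y | lca-view d l r x y
       | lca (node d l r) y z | lca-view d l r y z
  ... | _ | apart _ _   | _ | _           = inj₁ (lca-⊆ (node d l r) x z)
  ... | _ | left _ _    | _ | apart _ _   = inj₂ (lca-⊆ (node d l r) x z)
  ... | _ | right _ _   | _ | apart _ _   = inj₂ (lca-⊆ (node d l r) x z)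
  ... | _ | left _ y∈S  | _ | right y∈T _ = contradiction y∈T (disjoint d y∈S)
  ... | _ | right _ y∈T | _ | left y∈S _  = contradiction y∈T (disjoint d y∈S)
  ... | _ | left x∈S _  | _ | left _ z∈S
    with lca (node d l r) x z | lca-view d l r x z
  ...   | _ | left _ _    = lca-ultra l x y z
  ...   | _ | right x∈T _ = contradiction x∈T (disjoint d x∈S)
  ...   | _ | apart ¬S _  = contradiction (x∈S , z∈S) ¬S
  lca-ultra (node d l r) x y z | _ | right x∈T _ | _ | right _ z∈T
    with lca (node d l r) x z | lca-view d l r x z
  ...   | _ | left x∈S _  = contradiction x∈T (disjoint d x∈S)
  ...   | _ | right _ _   = lca-ultra r x y z
  ...   | _ | apart _ ¬T  = contradiction (x∈T , z∈T) ¬T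

------------------------------------------------------------------------
-- Agglomeration of connected clusters

module _ {n : ℕ} where

  _++ʷ_ : ∀ {E : Rel (Fin n) 0ℓ} {j k x y z} →
          Walk E j x y → Walk E k y z → ∃[ m ] Walk E m x z
  []      ++ʷ q = _ , q
  (e ∷ p) ++ʷ q = let _ , r = p ++ʷ q in _ , e ∷ r

  mapWalk : ∀ {D E : Rel (Fin n) 0ℓ} → (∀ {x y} → D x y → E x y) →
            ∀ {k x y} → Walk D k x y → Walk E k x y
  mapWalk f []      = []
  mapWalk f (e ∷ p) = f e ∷ mapWalk f p

  allClusters-root : ∀ {P : Subset n → Set} {S} (t : Tree S) →
                     AllClusters P t → P S
  allClusters-root (leaf _)     p       = p
  allClusters-root (node _ _ _) (p , _) = p

module Agglomeration {n : ℕ} (G : Graph n) where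
  open Graph G

  WalkIn : Subset n → Fin n → Fin n → Set
  WalkIn S x y = ∃[ k ] Walk (λ a b → a ∈ S × b ∈ S × a ~ b) k x y

  walkIn-⊆ : ∀ {S U x y} → S ⊆ U → WalkIn S x y → WalkIn U x y
  walkIn-⊆ S⊆U (_ , p) = _ , mapWalk (λ (a∈ , b∈ , e) → S⊆U a∈ , S⊆U b∈ , e) p

  connected-singleton : ∀ x → InducesConnected G ⁅ x ⁆
  connected-singleton z x y x∈ y∈
    with refl ← x∈⁅y⁆⇒x≡y z x∈ | refl ← x∈⁅y⁆⇒x≡y z y∈ = 0 , []

  connected-∪ : ∀ {S T x y} → InducesConnected G S → InducesConnected G T →
                x ∈ S → y ∈ T → x ~ y → InducesConnected G (S ∪ T)
  connected-∪ {S} {T} {x} {y} connS connT x∈S y∈T x~y a b a∈ b∈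
    with x∈p∪q⁻ S T a∈ | x∈p∪q⁻ S T b∈
  ... | inj₁ a∈S | inj₁ b∈S = walkIn-⊆ (p⊆p∪q T) (connS a b a∈S b∈S)
  ... | inj₂ a∈T | inj₂ b∈T = walkIn-⊆ (q⊆p∪q S T) (connT a b a∈T b∈T)
  ... | inj₁ a∈S | inj₂ b∈T =
    let _ , p = walkIn-⊆ (p⊆p∪q T) (connS a x a∈S x∈S)
        _ , q = walkIn-⊆ (q⊆p∪q S T) (connT y b y∈T b∈T)
    in p ++ʷ ((p⊆p∪q T x∈S , q⊆p∪q S T y∈T , x~y) ∷ q)
  ... | inj₂ a∈T | inj₁ b∈S =
    let _ , p = walkIn-⊆ (q⊆p∪q S T) (connT a y a∈T y∈T)
        _ , q = walkIn-⊆ (p⊆p∪q T) (connS x b x∈S b∈S)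
    in p ++ʷ ((q⊆p∪q S T y∈T , p⊆p∪q T x∈S , ~-sym x~y) ∷ q)

  -- A partition of the vertices into connected clusters, each with a tree on
  -- it. Every vertex carries its cluster together with the tree, so that one
  -- equation (coherent) says that clusters are equal or disjoint and that
  -- vertices of a cluster agree on its tree.
  record Forest : Set where
    field
      component : Fin n → ∃ (Tree {n})

    cluster : Fin n → Subset n
    cluster x = proj₁ (component x)

    tree : ∀ x → Tree (cluster x)
    tree x = proj₂ (component x)

    field
      self      : ∀ x → x ∈ cluster x
      coherent  : ∀ {x y} → y ∈ cluster x → component y ≡ component x
      connected : ∀ x → AllClusters (InducesConnected G) (tree x)

    coherent-∈ : ∀ {x y z} → y ∈ cluster x → z ∈ cluster y → z ∈ cluster x
    coherent-∈ y∈ z∈ = subst (λ b → _ ∈ proj₁ b) (coherent y∈) z∈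

    symmetric : ∀ {x y} → y ∈ cluster x → x ∈ cluster y
    symmetric y∈ = subst (λ b → _ ∈ proj₁ b) (sym (coherent y∈)) (self _)

    Crossing : Fin n × Fin n → Set
    Crossing (x , y) = x ~ y × y ∉ cluster x

    crossing? : ∀ e → Dec (Crossing e)
    crossing? (x , y) = (x ~? y) ×-dec ¬? (y ∈? cluster x)

    -- If no edge crosses, consecutive vertices of a walk share their cluster.
    noCrossing⇒full : Connected G → (∀ e → ¬ Crossing e) → ∀ x y → y ∈ cluster x
    noCrossing⇒full conn none x y = reach (proj₂ (conn x y))
      where
      reach : ∀ {k x y} → Walk _~_ k x y → y ∈ cluster x
      reach []                  = self _
      reach {x = x} (_∷_ {y = z} e p) with z ∈? cluster x
      ... | yes z∈ = coherent-∈ z∈ (reach p)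
      ... | no z∉  = contradiction (e , z∉) (none (x , z))

  open Forest

  singletons : Forest
  singletons = record
    { component = λ x → _ , leaf x
    ; self      = x∈⁅x⁆
    ; coherent  = λ {x} y∈ → cong (λ z → _ , leaf z) (x∈⁅y⁆⇒x≡y x y∈)
    ; connected = connected-singleton
    }

  module Merge (F : Forest) {x y : Fin n} (cross : Crossing F (x , y)) where

    M : Subset n
    M = cluster F x ∪ cluster F y

    disjointClusters : Empty (cluster F x ∩ cluster F y)
    disjointClusters (z , z∈) =
      let z∈x , z∈y = x∈p∩q⁻ (cluster F x) (cluster F y) z∈
      in proj₂ cross (coherent-∈ F z∈x (symmetric F z∈y))

    M-tree : Tree M
    M-tree = node disjointClusters (tree F x) (tree F y)

    component′ : Fin n → ∃ (Tree {n})
    component′ z = if does (z ∈? M) then (M , M-tree) else component F z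

    data ComponentView (z : Fin n) : ∃ (Tree {n}) → Set where
      new : z ∈ M → ComponentView z (M , M-tree)
      old : z ∉ M → ComponentView z (component F z)

    componentView : ∀ z → ComponentView z (component′ z)
    componentView z with z ∈? M
    ... | yes z∈M = new z∈M
    ... | no z∉M  = old z∉M

    -- M is a union of clusters of F, so a cluster meeting it lies inside it.
    M-closed : ∀ {z w} → z ∈ M → w ∈ cluster F z → w ∈ M
    M-closed z∈M w∈ with x∈p∪q⁻ (cluster F x) (cluster F y) z∈M
    ... | inj₁ z∈x = p⊆p∪q _ (coherent-∈ F z∈x w∈)
    ... | inj₂ z∈y = q⊆p∪q _ _ (coherent-∈ F z∈y w∈)

    self′ : ∀ z → z ∈ proj₁ (component′ z)
    self′ z with component′ z | componentView z
    ... | _ | new z∈M = z∈M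
    ... | _ | old _   = self F z

    coherent′ : ∀ {z w} → w ∈ proj₁ (component′ z) → component′ w ≡ component′ z
    coherent′ {z} {w} w∈ with component′ z | componentView z | component′ w | componentView w
    ... | _ | new _   | _ | new _   = refl
    ... | _ | new _   | _ | old w∉M = contradiction w∈ w∉M
    ... | _ | old z∉M | _ | new w∈M = contradiction (M-closed w∈M (symmetric F w∈)) z∉M
    ... | _ | old _   | _ | old _   = coherent F w∈

    connected′ : ∀ z → AllClusters (InducesConnected G) (proj₂ (component′ z))
    connected′ z with component′ z | componentView z
    ... | _ | old _ = connected F z
    ... | _ | new _ =
      connected-∪ (allClusters-root (tree F x) (connected F x))
                  (allClusters-root (tree F y) (connected F y))
                  (self F x) (self F y) (proj₁ cross) ,
      connected F x , connected F y

    merge : Forest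
    merge = record
      { component = component′
      ; self      = self′
      ; coherent  = coherent′
      ; connected = connected′
      }

    cluster-grows : ∀ z → cluster F z ⊆ cluster merge z
    cluster-grows z w∈ with component′ z | componentView z
    ... | _ | new z∈M = M-closed z∈M w∈
    ... | _ | old _   = w∈

    crossing-shrinks : ∀ {e} → Crossing merge e → Crossing F e
    crossing-shrinks (p~q , q∉) = p~q , q∉ ∘ cluster-grows _

    merged : ¬ Crossing merge (x , y)
    merged (_ , y∉) with component′ x | componentView x
    ... | _ | new _   = y∉ (q⊆p∪q _ _ (self F y))
    ... | _ | old x∉M = x∉M (p⊆p∪q _ (self F x))

------------------------------------------------------------------------
-- Distances and diameters

module _ {n : ℕ} (G : Graph n) (conn : Connected G) where
  open Graph G

  dist-refl : ∀ x → dist G conn x x ≡ 0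
  dist-refl x = ℕ.n≤0⇒n≡0 (proj₂ (proj₂ (shortest G conn x x)) 0 [])

  dist≡0⇒≡ : ∀ {x y} → dist G conn x y ≡ 0 → x ≡ y
  dist≡0⇒≡ {x} {y} eq
    with [] ← subst (λ k → Walk _~_ k x y) eq (proj₁ (proj₂ (shortest G conn x y)))
    = refl

  dist≤diam : ∀ {S a b} → a ∈ S → b ∈ S → dist G conn a b ≤ diam G conn S
  dist≤diam {S} {a} {b} a∈S b∈S =
    All.lookup (xs≤max 0 _)
      (∈-cartesianProductWith⁺ (dist G conn)
        (∈-filter⁺ (_∈? S) (∈-allFin a) a∈S) (∈-filter⁺ (_∈? S) (∈-allFin b) b∈S))

  -- A diameter is either attained by two points or is the default value 0.
  diam-elim : ∀ {S} (P : ℕ → Set) → P 0 →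
              (∀ {a b} → a ∈ S → b ∈ S → P (dist G conn a b)) →
              P (diam G conn S)
  diam-elim {S} P p₀ p = argmax-all id {P = P} p₀
    (cartesianProductWith⁺ (setoid _) (setoid _) (dist G conn) _ _ λ a∈ b∈ →
      p (proj₂ (∈-filter⁻ (_∈? S) {xs = allFin n} a∈))
        (proj₂ (∈-filter⁻ (_∈? S) {xs = allFin n} b∈)))

  diam-mono : ∀ {S T} → S ⊆ T → diam G conn S ≤ diam G conn T
  diam-mono {S} {T} S⊆T = diam-elim (_≤ diam G conn T) z≤n
    (λ a∈ b∈ → dist≤diam (S⊆T a∈) (S⊆T b∈))

------------------------------------------------------------------------
-- Real numbers and monotonicity of the cost

module _ (ℝ : Reals) where
  open Reals ℝ renaming (_≤_ to _≤ᴿ_)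
  open CommutativeRing commutativeRing
    using ( -_; ring; +-comm; +-identityˡ; +-identityʳ; +-assoc; +-congˡ
          ; *-congˡ; -‿inverseˡ; -‿inverseʳ; distribˡ)
  open RingProperties ring using (-1*x≈-x; -‿involutive)
  private module O = DecTotalOrder decTotalOrder
  open NaturalMax O.totalOrder using (x≤x⊔y; x≤y⊔x; ⊔-lub)

  ≤-resp : ∀ {a a′ b b′} → a ≈ a′ → b ≈ b′ → a ≤ᴿ b → a′ ≤ᴿ b′
  ≤-resp a≈ b≈ a≤b = O.≤-respˡ-≈ a≈ (O.≤-respʳ-≈ b≈ a≤b)

  +-mono-≤ : ∀ {a b c d} → a ≤ᴿ b → c ≤ᴿ d → (a + c) ≤ᴿ (b + d)
  +-mono-≤ {a} {b} {c} {d} a≤b c≤d = O.trans (+-monoˡ-≤ c a≤b)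
    (≤-resp (+-comm c b) (+-comm d b) (+-monoˡ-≤ b c≤d))

  -- If 1 were at most 0, then -1 would be nonnegative, and so would its square.
  0≤1 : 0# ≤ᴿ 1#
  0≤1 with O.total 0# 1#
  ... | inj₁ 0≤1 = 0≤1
  ... | inj₂ 1≤0 =
    O.≤-respʳ-≈ (O.Eq.trans (-1*x≈-x (- 1#)) (-‿involutive 1#)) (*-nonNegative 0≤-1 0≤-1)
    where
    0≤-1 : 0# ≤ᴿ - 1#
    0≤-1 = ≤-resp (-‿inverseʳ 1#) (+-identityˡ (- 1#)) (+-monoˡ-≤ (- 1#) 1≤0)

  -- Nonnegativity of products, applied to the factor b - a.
  *-monoʳ-≤ : ∀ {c a b} → 0# ≤ᴿ c → a ≤ᴿ b → (c * a) ≤ᴿ (c * b)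
  *-monoʳ-≤ {c} {a} {b} 0≤c a≤b =
    ≤-resp (+-identityˡ (c * a))
      (O.Eq.trans (O.Eq.sym (distribˡ c (b + - a) a)) (*-congˡ b-a+a≈b))
      (+-monoˡ-≤ (c * a) (*-nonNegative 0≤c 0≤b-a))
    where
    0≤b-a : 0# ≤ᴿ (b + - a)
    0≤b-a = O.≤-respˡ-≈ (-‿inverseʳ a) (+-monoˡ-≤ (- a) a≤b)
    b-a+a≈b : ((b + - a) + a) ≈ b
    b-a+a≈b = O.Eq.trans (+-assoc b (- a) a)
      (O.Eq.trans (+-congˡ (-‿inverseˡ a)) (+-identityʳ b))

  fromℕ-nonNegative : ∀ k → 0# ≤ᴿ fromℕ k
  fromℕ-nonNegative zero    = O.refl
  fromℕ-nonNegative (suc k) =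
    O.≤-respˡ-≈ (+-identityˡ 0#) (+-mono-≤ 0≤1 (fromℕ-nonNegative k))

  fromℕ-mono : ∀ {j k} → j ≤ k → fromℕ j ≤ᴿ fromℕ k
  fromℕ-mono {k = k} z≤n = fromℕ-nonNegative k
  fromℕ-mono (s≤s j≤k)   = +-mono-≤ O.refl (fromℕ-mono j≤k)

  fromℕ≈0⇒≡0 : ∀ k → fromℕ k ≈ 0# → k ≡ 0
  fromℕ≈0⇒≡0 zero    _  = refl
  fromℕ≈0⇒≡0 (suc k) eq = contradiction (O.antisym 0≤1 1≤0) 0≉1
    where
    1≤0 : 1# ≤ᴿ 0#
    1≤0 = ≤-resp (+-identityʳ 1#) eq (+-mono-≤ {1#} {1#} O.refl (fromℕ-nonNegative k))

  sum-mono : ∀ {m} {f g : Fin m → Carrier} → (∀ i → f i ≤ᴿ g i) → sum f ≤ᴿ sum g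
  sum-mono {zero}  f≤g = O.refl
  sum-mono {suc m} f≤g = +-mono-≤ (f≤g zero) (sum-mono (f≤g ∘ suc))

  when-mono : ∀ {P : Set} (P? : Dec P) {f g : P → Carrier} →
              (∀ p → f p ≤ᴿ g p) → when ℝ P? f ≤ᴿ when ℝ P? g
  when-mono (yes p) f≤g = f≤g p
  when-mono (no _)  f≤g = O.refl

  minimiser : ∀ {m} (f : Fin (suc m) → Carrier) → ∃[ i ] (∀ j → f i ≤ᴿ f j)
  minimiser f = argmin f zero (allFin _) , λ j →
    All.lookup (f[argmin]≤f[xs] zero (allFin _)) (∈-allFin j)
    where open Extrema O.totalOrder using (argmin; f[argmin]≤f[xs])

  module _ {n : ℕ} {G : Graph n} (W : Weighting ℝ G) where
    open Graph G
    open Weighting W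

    -- The labels of a greedy hierarchy are controlled on edges only, so the
    -- comparison must not be asked for on other pairs.
    cost-mono : ∀ {u v : Fin n → Fin n → Carrier} →
                (∀ {x y} → x ~ y → u x y ≤ᴿ v x y) → cost ℝ W u ≤ᴿ cost ℝ W v
    cost-mono u≤v = sum-mono λ x → sum-mono λ y →
      when-mono ((x <? y) ×-dec (x ~? y)) λ (_ , p) → *-monoʳ-≤ (proj₁ (w-pos p)) (u≤v p)

------------------------------------------------------------------------
-- Diameter labelings

  module _ {n : ℕ} (G : Graph n) (conn : Connected G) where

    -- Defined for a tree on any cluster, so as to label the partial trees of a
    -- forest; no case distinction on the diagonal, where no edge lies.
    lcaDiam : ∀ {S : Subset n} → Tree S → Fin n → Fin n → Carrier
    lcaDiam t x y = fromℕ (diam G conn (lca t x y))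

    module _ (T : Hierarchy n) where

      private
        D : Fin n → Fin n → Carrier
        D = diamLabeling ℝ G conn T

      dist≤lcaDiam : ∀ x y → fromℕ (dist G conn x y) ≤ᴿ lcaDiam T x y
      dist≤lcaDiam x y =
        let x∈ , y∈ = lca-∋ T ∈⊤ ∈⊤ in fromℕ-mono (dist≤diam G conn x∈ y∈)

      private
        lcaDiam-nonNegative : ∀ x y → 0# ≤ᴿ lcaDiam T x y
        lcaDiam-nonNegative x y = fromℕ-nonNegative (diam G conn (lca T x y))

        lcaDiam-mono : ∀ a b x y → lca T a b ⊆ lca T x y →
                       lcaDiam T a b ≤ᴿ lcaDiam T x y
        lcaDiam-mono a b x y ⊆xy =
          fromℕ-mono (diam-mono G conn {lca T a b} {lca T x y} ⊆xy)

        lcaDiam-sym-≤ : ∀ x y → lcaDiam T x y ≤ᴿ lcaDiam T y x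
        lcaDiam-sym-≤ x y =
          let y∈ , x∈ = lca-∋ T {y} {x} ∈⊤ ∈⊤
          in lcaDiam-mono x y y x (lca-least T y x x∈ y∈)

        lcaDiam-ultra : ∀ x y z → lcaDiam T x z ≤ᴿ (lcaDiam T x y ⊔ lcaDiam T y z)
        lcaDiam-ultra x y z =
          [ (λ (⊆xy : lca T x z ⊆ lca T x y) →
               O.trans (lcaDiam-mono x z x y ⊆xy) (x≤x⊔y (lcaDiam T x y) (lcaDiam T y z)))
          , (λ (⊆yz : lca T x z ⊆ lca T y z) →
               O.trans (lcaDiam-mono x z y z ⊆yz) (x≤y⊔x (lcaDiam T x y) (lcaDiam T y z)))
          ]′ (lca-ultra T x y z)

      diamLabeling≤lcaDiam : ∀ x y → D x y ≤ᴿ lcaDiam T x y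
      diamLabeling≤lcaDiam x y with x ≟ y
      ... | yes _ = lcaDiam-nonNegative x y
      ... | no _  = O.refl

      lcaDiam≤diamLabeling : ∀ {x y} → x ≢ y → lcaDiam T x y ≤ᴿ D x y
      lcaDiam≤diamLabeling {x} {y} x≢y with x ≟ y
      ... | yes x≡y = contradiction x≡y x≢y
      ... | no _    = O.refl

      diamLabeling-dominates : Dominates ℝ G conn D
      diamLabeling-dominates x y with x ≟ y
      ... | yes refl = O.reflexive (O.Eq.reflexive (cong fromℕ (dist-refl G conn x)))
      ... | no _     = dist≤lcaDiam x y

      private
        nonNegative : ∀ {x y} → 0# ≤ᴿ D x y
        nonNegative {x} {y} with x ≟ y
        ... | yes _ = O.refl
        ... | no _  = lcaDiam-nonNegative x y

        definite : ∀ {x y} → x ≡ y → D x y ≈ 0#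
        definite {x} {y} x≡y with x ≟ y
        ... | yes _  = O.Eq.refl
        ... | no x≢y = contradiction x≡y x≢y

        indiscernible : ∀ {x y} → D x y ≈ 0# → x ≡ y
        indiscernible {x} {y} D≈0 = dist≡0⇒≡ G conn (fromℕ≈0⇒≡0 (dist G conn x y)
          (O.antisym (O.≤-respʳ-≈ D≈0 (diamLabeling-dominates x y))
                     (fromℕ-nonNegative (dist G conn x y))))

        symmetric-≤ : ∀ x y → D x y ≤ᴿ D y x
        symmetric-≤ x y with y ≟ x
        ... | yes refl = O.reflexive (definite refl)
        ... | no _     = O.trans (diamLabeling≤lcaDiam x y) (lcaDiam-sym-≤ x y)

        ultra : ∀ x y z → D x z ≤ᴿ (D x y ⊔ D y z)
        ultra x y z with x ≟ y
        ... | yes refl = x≤y⊔x _ _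
        ... | no _ with y ≟ z
        ...   | yes refl = O.trans (diamLabeling≤lcaDiam x y) (x≤x⊔y _ _)
        ...   | no _     = O.trans (diamLabeling≤lcaDiam x z) (lcaDiam-ultra x y z)

        triangle : ∀ x y z → D x z ≤ᴿ (D x y + D y z)
        triangle x y z = O.trans (ultra x y z) (⊔-lub
          (O.≤-respˡ-≈ (+-identityʳ _) (+-mono-≤ O.refl (nonNegative {y} {z})))
          (O.≤-respˡ-≈ (+-identityˡ _) (+-mono-≤ (nonNegative {x} {y}) O.refl)))

      diamLabeling-ultrametric : IsUltrametric ℝ D
      diamLabeling-ultrametric = record
        { isMetric = record
          { isSemiMetric = record
            { isQuasiSemiMetric = record
              { isPreMetric = record
                { isProtoMetric = record
                  { isPartialOrder  = O.isPartialOrder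
                  ; ≈-isEquivalence = isEquivalence
                  ; cong            = λ { refl refl → O.Eq.refl }
                  ; nonNegative     = nonNegative
                  }
                ; ≈⇒0 = definite
                }
              ; 0⇒≈ = indiscernible
              }
            ; sym = λ x y → O.antisym (symmetric-≤ x y) (symmetric-≤ y x)
            }
          ; triangle = triangle
          }
        ; ultratriangle = ultra
        }

    cost-diamLabeling : (W : Weighting ℝ G) (T : Hierarchy n) →
                        cost ℝ W (diamLabeling ℝ G conn T) ≈ cost ℝ W (lcaDiam T)
    cost-diamLabeling W T = O.antisym
      (cost-mono W λ {x} {y} _ → diamLabeling≤lcaDiam T x y)
      (cost-mono W λ {x} x~y →
        lcaDiam≤diamLabeling T λ { refl → Graph.~-irrefl G x~y })

------------------------------------------------------------------------
-- Greedy merging below an ultrametric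

    open Agglomeration G
    open Forest
    open Graph G

    -- The invariant of greedy merging, saying that the forest can arise from
    -- u: on edges, the labels fixed so far are at most u, and no u-distance
    -- inside a cluster exceeds the least u-value of a crossing edge.
    record Respects (u : Fin n → Fin n → Carrier) (F : Forest) : Set where
      field
        inside  : ∀ {x y} → x ~ y → y ∈ cluster F x → lcaDiam (tree F x) x y ≤ᴿ u x y
        between : ∀ {x y} → Crossing F (x , y) →
                  ∀ z {a b} → a ∈ cluster F z → b ∈ cluster F z → u a b ≤ᴿ u x y

    module _ {u : Fin n → Fin n → Carrier} (ultrametric : IsUltrametric ℝ u)
             (dominates : Dominates ℝ G conn u) where

      open IsUltrametric ultrametric
      private module U = IsGeneralMetric isMetric
      open Respects

      respects-singletons : Respects u singletons
      respects-singletons = record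
        { inside  = λ {x} x~y y∈ →
            contradiction (subst (x ~_) (x∈⁅y⁆⇒x≡y x y∈) x~y) ~-irrefl
        ; between = λ _ z a∈ b∈ →
            O.trans (O.reflexive (U.≈⇒0 (trans (x∈⁅y⁆⇒x≡y z a∈) (sym (x∈⁅y⁆⇒x≡y z b∈)))))
                    U.nonNegative
        }

      module _ {F : Forest} {x y : Fin n} (cross : Crossing F (x , y)) (R : Respects u F)
               (minimal : ∀ {p q} → Crossing F (p , q) → u x y ≤ᴿ u p q) where

        open Merge F cross

        -- If a and b lie in different clusters, go from a to the end of xy in
        -- its cluster, over xy, and on to b. As xy itself crosses, the
        -- invariant bounds each of the three pieces by u(x,y).
        M-bounded : ∀ {a b} → a ∈ M → b ∈ M → u a b ≤ᴿ u x y
        M-bounded {a} {b} a∈ b∈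
          with x∈p∪q⁻ (cluster F x) (cluster F y) a∈ | x∈p∪q⁻ (cluster F x) (cluster F y) b∈
        ... | inj₁ a∈x | inj₁ b∈x = between R cross x a∈x b∈x
        ... | inj₂ a∈y | inj₂ b∈y = between R cross y a∈y b∈y
        ... | inj₁ a∈x | inj₂ b∈y =
          O.trans (ultratriangle a x b) (⊔-lub (between R cross x a∈x (self F x))
            (O.trans (ultratriangle x y b) (⊔-lub O.refl (between R cross y (self F y) b∈y))))
        ... | inj₂ a∈y | inj₁ b∈x =
          O.trans (ultratriangle a y b) (⊔-lub (between R cross y a∈y (self F y))
            (O.trans (ultratriangle y x b)
              (⊔-lub (O.reflexive (U.sym y x)) (between R cross x (self F x) b∈x))))

        M-diam : fromℕ (diam G conn M) ≤ᴿ u x y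
        M-diam = diam-elim G conn (λ k → fromℕ k ≤ᴿ u x y) U.nonNegative
          λ {a} {b} a∈ b∈ → O.trans (dominates a b) (M-bounded a∈ b∈)

        M-crossing : ∀ {p q} → p ~ q → p ∈ M → q ∈ M →
                     ¬ (p ∈ cluster F x × q ∈ cluster F x) →
                     ¬ (p ∈ cluster F y × q ∈ cluster F y) → Crossing F (p , q)
        M-crossing p~q p∈ q∈ ¬x ¬y with x∈p∪q⁻ (cluster F x) (cluster F y) p∈
        ... | inj₁ p∈x = p~q , λ q∈p → ¬x (p∈x , coherent-∈ F p∈x q∈p)
        ... | inj₂ p∈y = p~q , λ q∈p → ¬y (p∈y , coherent-∈ F p∈y q∈p)

        inside-cluster : ∀ {p q} z → p ~ q → p ∈ cluster F z → q ∈ cluster F z →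
                         lcaDiam (tree F z) p q ≤ᴿ u p q
        inside-cluster {p} {q} z p~q p∈ q∈ =
          subst (λ b → lcaDiam (proj₂ b) p q ≤ᴿ u p q) (coherent F p∈)
            (inside R p~q (coherent-∈ F (symmetric F p∈) q∈))

        -- An edge whose ends have the new node as lowest common ancestor was
        -- a crossing edge before the merge, so minimality applies to it. All
        -- other edges inside clusters keep their labels.
        respects-merge : Respects u merge
        respects-merge = record { inside = inside′ ; between = between′ }
          where
          inside′ : ∀ {p q} → p ~ q → q ∈ cluster merge p → lcaDiam (tree merge p) p q ≤ᴿ u p q
          inside′ {p} {q} p~q q∈ with component′ p | componentView p
          ... | _ | old _ = inside R p~q q∈
          ... | _ | new p∈
            with lca M-tree p q | lca-view disjointClusters (tree F x) (tree F y) p q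
          ...   | _ | left p∈x q∈x  = inside-cluster x p~q p∈x q∈x
          ...   | _ | right p∈y q∈y = inside-cluster y p~q p∈y q∈y
          ...   | _ | apart ¬x ¬y   = O.trans M-diam (minimal (M-crossing p~q p∈ q∈ ¬x ¬y))

          between′ : ∀ {p q} → Crossing merge (p , q) →
                     ∀ z {a b} → a ∈ cluster merge z → b ∈ cluster merge z → u a b ≤ᴿ u p q
          between′ c z a∈ b∈ with component′ z | componentView z
          ... | _ | old _ = between R (crossing-shrinks c) z a∈ b∈
          ... | _ | new _ = O.trans (M-bounded a∈ b∈) (minimal (crossing-shrinks c))

------------------------------------------------------------------------
-- The cheapest hierarchy

    Enumerates : List (Fin n × Fin n) → Forest → Set
    Enumerates L F = ∀ e → (e ∈ₗ L → Crossing F e) × (Crossing F e → e ∈ₗ L)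

    -- The index of a tree covering all vertices equals the full set only
    -- propositionally; matching on that equation makes it a hierarchy.
    fullTree : ∀ {P : Subset n → Set} ((S , t) : ∃ (Tree {n})) → (∀ y → y ∈ S) →
               AllClusters P t →
               ∃ λ (T : Hierarchy n) → AllClusters P T × (∀ x y → lca T x y ≡ lca t x y)
    fullTree (S , t) full p
      with refl ← ⊆-antisym {i = S} ⊆⊤ (λ {y} _ → full y) = t , p , λ _ _ → refl

    module _ (W : Weighting ℝ G) (x₀ : Fin n) where

      CheapestAbove : Forest → Set
      CheapestAbove F =
        ∃[ T ] ConnectedHierarchy G T ×
          (∀ {u} → IsUltrametric ℝ u → Dominates ℝ G conn u → Respects u F →
           cost ℝ W (lcaDiam T) ≤ᴿ cost ℝ W u)

      -- The number k bounds the number of crossing edges; merging along one of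
      -- them makes it internal and creates no new ones, so k can decrease.
      -- The branch kept depends on F alone, and an ultrametric is compared with
      -- it through the branch of its own least crossing edge: this is how one
      -- hierarchy can serve all ultrametrics.
      cheapestAbove : ∀ k F L → Enumerates L F → length L ≤ k → CheapestAbove F
      cheapestAbove _ F [] enum _ =
        -- No edge crosses any more, so the tree at x₀ is the tree of every vertex.
        let full           = noCrossing⇒full F conn λ e c → contradiction (proj₂ (enum e) c) λ ()
            T , connT , eq = fullTree (component F x₀) (full x₀) (connected F x₀)
        in T , connT , λ {u} _ _ R → cost-mono W λ {x} {y} x~y →
             subst (λ S → fromℕ (diam G conn S) ≤ᴿ u x y) (sym (eq x y))
               (subst (λ b → lcaDiam (proj₂ b) x y ≤ᴿ u x y) (coherent F (full x₀ x))
                 (Respects.inside R x~y (full x y)))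
      cheapestAbove (suc k) F L@(_ ∷ _) enum (s≤s len) =
        -- i is the branch kept, j the branch that u itself would take.
        let i , best = minimiser λ j → cost ℝ W (lcaDiam (proj₁ (child j)))
        in proj₁ (child i) , proj₁ (proj₂ (child i)) , λ {u} um dom R →
             let j , least = minimiser λ j → u (proj₁ (lookup L j)) (proj₂ (lookup L j))
                 minimal   = λ {p} {q} (c : Crossing F (p , q)) →
                   let e∈ = proj₂ (enum (p , q)) c in
                   subst (λ (p , q) → _ ≤ᴿ u p q) (sym (lookup-index e∈)) (least (index e∈))
             in O.trans (best j)
                  (proj₂ (proj₂ (child j)) um dom (respects-merge um dom (crosses j) R minimal))
        where
        crosses : ∀ j → Crossing F (lookup L j)
        crosses j = proj₁ (enum (lookup L j)) (∈-lookup j)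

        child : ∀ j → CheapestAbove (Merge.merge F (crosses j))
        child j = cheapestAbove k merge (filter (crossing? merge) L)
          (λ e → (λ e∈ → proj₂ (∈-filter⁻ (crossing? merge) {xs = L} e∈))
               , (λ c → ∈-filter⁺ (crossing? merge) (proj₂ (enum e) (crossing-shrinks c)) c))
          (ℕ.≤-pred (ℕ.≤-trans
            (filter-notAll (crossing? merge) L (lose (∈-lookup j) merged)) (s≤s len)))
          where open Merge F (crosses j)

      cheapest : ∃[ T ] ConnectedHierarchy G T ×
                   (∀ {u} → IsUltrametric ℝ u → Dominates ℝ G conn u →
                    cost ℝ W (lcaDiam T) ≤ᴿ cost ℝ W u)
      cheapest =
        let T , connT , below = cheapestAbove _ singletons
              (filter (crossing? singletons) pairs) enum ℕ.≤-refl
        in T , connT , λ um dom → below um dom (respects-singletons um dom)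
        where
        pairs : List (Fin n × Fin n)
        pairs = cartesianProduct (allFin n) (allFin n)

        enum : Enumerates (filter (crossing? singletons) pairs) singletons
        enum (x , y) =
          (λ e∈ → proj₂ (∈-filter⁻ (crossing? singletons) {xs = pairs} e∈)) ,
          ∈-filter⁺ (crossing? singletons) (∈-cartesianProduct⁺ (∈-allFin x) (∈-allFin y))

corollary2 : (ℝ : Reals) (n : ℕ) → 2 ≤ n →
    (G : Graph n) (conn : Connected G) (W : Weighting ℝ G) →
    ∃[ opt ]
    IsOPTfree ℝ G conn W opt ×
    Reals.IsMinimum ℝ (HierarchyCost ℝ G conn W) opt ×
    (∃[ T ]
    ConnectedHierarchy G T ×
    IsUltrametric ℝ (diamLabeling ℝ G conn T) ×
    Dominates ℝ G conn (diamLabeling ℝ G conn T) ×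
    Reals._≈_ ℝ (cost ℝ W (diamLabeling ℝ G conn T)) opt)
corollary2 ℝ (suc _) _ G conn W =
  let T , connT , optimal = cheapest ℝ G conn W zero
      ultrametric = diamLabeling-ultrametric ℝ G conn
      dominates   = diamLabeling-dominates ℝ G conn
      cost≈       = cost-diamLabeling ℝ G conn W
  in cost ℝ W (lcaDiam ℝ G conn T)
   , ( (λ { _ (_ , um , dom , eq) → O.≤-respʳ-≈ eq (optimal um dom) })
     , λ b lower → lower _ (_ , ultrametric T , dominates T , cost≈ T))
   , ( (T , connT , O.Eq.refl)
     , λ { _ (T′ , _ , eq) → O.≤-respʳ-≈ (O.Eq.trans (cost≈ T′) eq)
                               (optimal (ultrametric T′) (dominates T′)) })
   , T , connT , ultrametric T , dominates T , cost≈ T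
  where module O = DecTotalOrder (Reals.decTotalOrder ℝ)
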